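{- Every tree is omnitonal.
   Context: Graphs are finite and simple; $e(G)=|E(G)|$. A $2$-coloring $E(K_n)=E(R)\cup E(B)$ is a partition of the edges of $K_n$ into red edges (forming $R$) and blue edges (forming $B$). An $(r,b)$-colored copy of $G$ (with $r+b=e(G)$) is a (not necessarily induced) subgraph of $K_n$ isomorphic to $G$ with exactly $r$ red and $b$ blue edges. ${\rm ot}(n,G)$ is the minimum non-negative integer $s$ such that every $2$-coloring $E(K_n)=E(R)\cup E(B)$ with $\min\{e(R),e(B)\}>s$ contains an $(r,b)$-colored copy of $G$ for every pair of integers $r,b\ge0$ with $r+b=e(G)$. The graph $G$ is omnitonal if for every sufficiently large $n$ such an integer exists non-vacuously, that is, ${\rm ot}(n,G)<\lfloor\frac12\binom n2\rfloor$ (so that there are colorings with $\min\{e(R),e(B)\}>{\rm ot}(n,G)$). -}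

module Defs where

open import Data.Bool using (Bool; false; not; T)
open import Data.Bool.Properties using (T?)
open import Data.Fin using (Fin; zero; suc; fromℕ; inject₁; _<?_)
open import Data.List using (List; length; filter; allFin; cartesianProduct)
open import Data.Nat as ℕ using (ℕ; _+_; _≤_; _≥_; _⊓_; _/_)
open import Data.Nat.Combinatorics using (_C_)
open import Data.Product using (Σ; ∃-syntax; _×_; _,_)
open import Function.Definitions using (Injective)
open import Relation.Binary.Construct.Closure.ReflexiveTransitive using (Star)
open import Relation.Binary.PropositionalEquality using (_≡_; _≢_)
open import Relation.Nullary using (¬_)
open import Relation.Nullary.Decidable using (_×-dec_)

record Graph (v : ℕ) : Set where
  field
    adj     : Fin v → Fin v → Bool
    adj-sym : ∀ x y → adj x y ≡ adj y x
    adj-irr : ∀ x → adj x x ≡ false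

  Adj : Fin v → Fin v → Set
  Adj x y = T (adj x y)

  -- Each edge is listed exactly once, with its smaller endpoint first.
  edges : List (Fin v × Fin v)
  edges = filter (λ (x , y) → (x <? y) ×-dec T? (adj x y))
                 (cartesianProduct (allFin v) (allFin v))

open Graph public

e : ∀ {v} → Graph v → ℕ
e G = length (edges G)

Connected : ∀ {v} → Graph v → Set
Connected {v} G = Fin v × (∀ x y → Star (Adj G) x y)

-- A cycle of length m + 3: distinct vertices c₀, …, c₍ₘ₊₂₎, cyclically adjacent.
record Cycle {v} (G : Graph v) : Set where
  field
    m     : ℕ
    c     : Fin (3 + m) → Fin v
    c-inj : Injective _≡_ _≡_ c
    step  : ∀ (i : Fin (2 + m)) → Adj G (c (inject₁ i)) (c (suc i))
    close : Adj G (c (fromℕ (2 + m))) (c zero)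

IsTree : ∀ {v} → Graph v → Set
IsTree G = Connected G × ¬ Cycle G

record TwoColoring (n : ℕ) : Set where
  field
    R         : Graph n
    B         : Graph n
    partition : ∀ {x y} → x ≢ y → adj B x y ≡ not (adj R x y)

open TwoColoring public

-- The number of edges xy of G whose image f(x)f(y) is an edge of H.
edgesInto : ∀ {v n} → Graph v → Graph n → (Fin v → Fin n) → ℕ
edgesInto G H f = length (filter (λ (x , y) → T? (adj H (f x) (f y))) (edges G))

-- A not necessarily induced subgraph of Kₙ isomorphic to G is the image of G
-- under an injection f of its vertices, with edge set { f(x)f(y) : xy ∈ E(G) }.
ColoredCopy : ∀ {v n} → Graph v → TwoColoring n → (r b : ℕ) → Set
ColoredCopy {v} {n} G χ r b =
  Σ (Fin v → Fin n) λ f →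
    Injective _≡_ _≡_ f × edgesInto G (R χ) f ≡ r × edgesInto G (B χ) f ≡ b

ForcesAllPatterns : ∀ {v} → ℕ → Graph v → ℕ → Set
ForcesAllPatterns n G s =
  ∀ (χ : TwoColoring n) → e (R χ) ⊓ e (B χ) ℕ.> s →
  ∀ r b → r + b ≡ e G → ColoredCopy G χ r b

-- s = ot(n, G).
IsOt : ∀ {v} → ℕ → Graph v → ℕ → Set
IsOt n G s =
  ForcesAllPatterns n G s × (∀ s′ → ForcesAllPatterns n G s′ → s ≤ s′)

Omnitonal : ∀ {v} → Graph v → Set
Omnitonal G =
  ∃[ N ] ∀ n → n ≥ N → ∃[ s ] (IsOt n G s × s ℕ.< (n C 2) / 2)

{-# OPTIONS --safe #-}
module Submission where

-- Only almost balanced colourings of Kₙ matter.  Put K = v + 1, let Y be the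
-- K-core of the blue graph (what remains after repeatedly deleting vertices of
-- blue degree < K) and X the K-core of the red graph inside Y.  If X is
-- nonempty, order the vertices of the tree so that each new one has exactly one
-- earlier neighbour, and embed greedily: the first r edges red, staying in X,
-- and the rest blue, staying in Y ⊇ X.  Exchanging the colours gives Y′ and X′.
-- If X and X′ are both empty, then Y spans O(n) red edges and all but O(n) of
-- the blue ones, so |Y| ≈ n/√2 by balance; likewise |Y′| ≈ n/√2.  Hence |Y ∩ Y′|
-- is linear in n, yet Y ∩ Y′ spans only O(n) edges of either colour, which is
-- impossible for large n.  The minimum defining ot(n, G) exists because
-- everything in sight is finite, hence decidable.

open import Data.Bool using (Bool; true; false; not; T; if_then_else_; _∧_; _∨_)
import Data.Bool.Properties as Bool
open import Data.Fin using (Fin; zero; suc; _≟_; fromℕ; inject₁; remQuot; combine; finToFun; funToFin)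
  renaming (_<?_ to _<ꟳ?_)
open import Data.Fin.Patterns using (0F; 1F)
open import Data.Fin.Properties using (any?; all?; <-cmp; remQuot-combine; finToFun-funToFin)
open import Data.List using (List; []; _∷_; _++_; map; filter; length; allFin; tabulate; cartesianProduct)
open import Data.List.Properties using (map-++; map-∘)
open import Data.Nat as ℕ
  using (ℕ; zero; suc; _+_; _*_; _∸_; _⊓_; _/_; _%_; _≤_; _<_; _>_; _≤?_; _<?_; z≤n; s≤s; pred; >-nonZero)
open import Data.Nat.Combinatorics using (_C_; nCk+nC[k+1]≡[n+1]C[k+1]; nC1≡n)
open import Data.Nat.DivMod using (m≡m%n+[m/n]*n; m%n<n; /-monoˡ-≤)
open import Data.Nat.ListAction using () renaming (sum to total)
open import Data.Nat.ListAction.Properties using (sum-++)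
open import Data.Nat.Properties hiding (_≟_; _≤?_; _<?_; <-cmp)
open import Data.Nat.Tactic.RingSolver using (solve-∀)
open import Data.Product using (∃; ∃-syntax; _×_; _,_; proj₁; proj₂; uncurry)
open import Data.Sum using (_⊎_; inj₁; inj₂)
open import Data.Vec using (Vec; []; _∷_; lookup)
open import Data.Vec.Functional using (updateAt)
open import Data.Vec.Functional.Properties using (updateAt-updates; updateAt-minimal)
open import Data.Vec.Relation.Unary.All using ([]; _∷_)
open import Data.Vec.Relation.Unary.All.Properties using () renaming (lookup⁻ to All-lookup⁻)
open import Data.Vec.Relation.Unary.AllPairs using ([]; _∷_)
open import Data.Vec.Relation.Unary.Unique.Propositional using (Unique)
open import Data.Vec.Relation.Unary.Unique.Propositional.Properties using (lookup-injective)
open import Function using (_∘_; id; const; Equivalence)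
open import Function.Definitions using (Injective)
open import Relation.Binary.Construct.Closure.ReflexiveTransitive using (Star; ε; _◅_; _◅◅_; reverse; gmap)
open import Relation.Binary.Definitions using (tri<; tri≈; tri>)
open import Relation.Binary.PropositionalEquality
open import Relation.Nullary using (¬_; Dec; yes; no; does; contradiction; ¬?)
open import Relation.Nullary.Decidable using (_×-dec_; _→-dec_; dec-true; dec-false; decidable-stable; map′)
open import Algebra.Properties.Semiring.Sum +-*-semiring
  using (sum; sum-cong-≗; ∑-distrib-+; ∑-comm; *-distribˡ-sum; *-distribʳ-sum)
open import Defs

-- Sums and bilinear forms

sum-mono-≤ : ∀ {n} {f g : Fin n → ℕ} → (∀ i → f i ≤ g i) → sum f ≤ sum g
sum-mono-≤ {zero}  f≤g = z≤n
sum-mono-≤ {suc n} f≤g = +-mono-≤ (f≤g zero) (sum-mono-≤ (f≤g ∘ suc))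

term≤sum : ∀ {n} (f : Fin n → ℕ) i → f i ≤ sum f
term≤sum f zero    = m≤m+n _ _
term≤sum f (suc i) = ≤-trans (term≤sum (f ∘ suc) i) (m≤n+m _ _)

sum-zero : ∀ {n} {f : Fin n → ℕ} → (∀ i → f i ≡ 0) → sum f ≡ 0
sum-zero {zero}  f≡0 = refl
sum-zero {suc n} f≡0 = cong₂ _+_ (f≡0 zero) (sum-zero (f≡0 ∘ suc))

sum-one : ∀ n → sum {n} (λ _ → 1) ≡ n
sum-one zero    = refl
sum-one (suc n) = cong suc (sum-one n)

𝟙 : Bool → ℕ
𝟙 true  = 1
𝟙 false = 0

𝟙-∧ : ∀ a b → 𝟙 (a ∧ b) ≡ 𝟙 a * 𝟙 b
𝟙-∧ true  b = sym (*-identityˡ _)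
𝟙-∧ false b = refl

𝟙≤1 : ∀ b → 𝟙 b ≤ 1
𝟙≤1 true  = ≤-refl
𝟙≤1 false = z≤n

δ : ∀ {n} → Fin n → Fin n → ℕ
δ z x = 𝟙 (does (z ≟ x))

sum-δ : ∀ {n} (z : Fin n) (g : Fin n → ℕ) → sum (λ x → δ z x * g x) ≡ g z
sum-δ zero    g = trans (cong₂ _+_ (*-identityˡ (g zero)) (sum-zero {f = λ i → 0 * g (suc i)} λ _ → refl)) (+-identityʳ _)
sum-δ (suc z) g = sum-δ z (g ∘ suc)

deg : ∀ {n} → (Fin n → Fin n → ℕ) → (Fin n → ℕ) → Fin n → ℕ
deg a q x = sum λ y → a x y * q y

-- The quadratic form of the matrix `a`. For an adjacency matrix and the indicator of a set it
-- counts ordered adjacent pairs, that is, twice the edges inside the set; working with it avoids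
-- choosing an orientation or dividing by 2.
form : ∀ {n} → (Fin n → Fin n → ℕ) → (Fin n → ℕ) → ℕ
form a p = sum λ x → p x * deg a p x

deg-mono : ∀ {n} (a : Fin n → Fin n → ℕ) {p q : Fin n → ℕ} →
           (∀ x → p x ≤ q x) → ∀ x → deg a p x ≤ deg a q x
deg-mono a p≤q x = sum-mono-≤ λ y → *-monoʳ-≤ (a x y) (p≤q y)

form-mono : ∀ {n} (a : Fin n → Fin n → ℕ) {p q : Fin n → ℕ} →
            (∀ x → p x ≤ q x) → form a p ≤ form a q
form-mono a p≤q = sum-mono-≤ λ x → *-mono-≤ (p≤q x) (deg-mono a p≤q x)

form-weight-mono : ∀ {n} {a b : Fin n → Fin n → ℕ} (p : Fin n → ℕ) →
                   (∀ x y → a x y ≤ b x y) → form a p ≤ form b p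
form-weight-mono p a≤b =
  sum-mono-≤ λ x → *-monoʳ-≤ (p x) (sum-mono-≤ λ y → *-monoˡ-≤ (p y) (a≤b x y))

-- The hypothesis compares whole summands, so two matrices may disagree wherever the weights vanish.
-- This lets an embedding be changed outside the set already placed.
form-cong : ∀ {n} {a b : Fin n → Fin n → ℕ} {p q : Fin n → ℕ} →
            (∀ x y → p x * (a x y * p y) ≡ q x * (b x y * q y)) → form a p ≡ form b q
form-cong {a = a} {b} {p} {q} eq = sum-cong-≗ λ x →
  trans (*-distribˡ-sum (p x) (λ y → a x y * p y))
  (trans (sum-cong-≗ (eq x)) (sym (*-distribˡ-sum (q x) (λ y → b x y * q y))))

form-+ : ∀ {n} (a b : Fin n → Fin n → ℕ) (p : Fin n → ℕ) →
         form (λ x y → a x y + b x y) p ≡ form a p + form b p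
form-+ a b p = trans (sum-cong-≗ λ x → trans
  (cong (p x *_) (trans (sum-cong-≗ λ y → *-distribʳ-+ (p y) (a x y) (b x y))
                        (∑-distrib-+ (λ y → a x y * p y) (λ y → b x y * p y))))
  (*-distribˡ-+ (p x) (deg a p x) (deg b p x)))
  (∑-distrib-+ (λ x → p x * deg a p x) (λ x → p x * deg b p x))

form-one : ∀ {n} (p : Fin n → ℕ) → form (λ _ _ → 1) p ≡ sum p * sum p
form-one p = trans (sum-cong-≗ λ x → cong (p x *_) (sum-cong-≗ λ y → *-identityˡ (p y)))
                   (sym (*-distribʳ-sum (sum p) p))

form-δ : ∀ {n} (p : Fin n → ℕ) → form δ p ≡ sum (λ x → p x * p x)
form-δ p = sum-cong-≗ λ x → cong (p x *_) (sum-δ x p)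

-- Expanding the form at `δ z + p` gives two cross terms, equal by symmetry, and the diagonal term
-- `a z z`, which is 0. Since `q` enters only through a pointwise equation, the same identity serves
-- for inserting a vertex and for deleting one.
form-insert : ∀ {n} {a : Fin n → Fin n → ℕ} {p q : Fin n → ℕ} {z} →
              (∀ x y → a x y ≡ a y x) → a z z ≡ 0 → (∀ x → q x ≡ δ z x + p x) →
              form a q ≡ 2 * deg a p z + form a p
form-insert {a = a} {p} {q} {z} a-sym a-irr q≡ = begin
  form a q
    ≡⟨ sum-cong-≗ (λ x → cong₂ _*_ (q≡ x) (deg-q x)) ⟩
  sum (λ x → (δ z x + p x) * (a x z + d x))
    ≡⟨ sum-cong-≗ (λ x → *-distribʳ-+ (a x z + d x) (δ z x) (p x)) ⟩
  sum (λ x → δ z x * (a x z + d x) + p x * (a x z + d x))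
    ≡⟨ ∑-distrib-+ (λ x → δ z x * (a x z + d x)) (λ x → p x * (a x z + d x)) ⟩
  sum (λ x → δ z x * (a x z + d x)) + sum (λ x → p x * (a x z + d x))
    ≡⟨ cong₂ _+_ (sum-δ z (λ x → a x z + d x))
         (trans (sum-cong-≗ λ x → trans (*-distribˡ-+ (p x) (a x z) (d x)) (cong (_+ p x * d x) (flip-term x)))
                (∑-distrib-+ (λ x → a z x * p x) (λ x → p x * d x))) ⟩
  a z z + d z + (d z + form a p)
    ≡⟨ cong (λ t → t + d z + (d z + form a p)) a-irr ⟩
  d z + (d z + form a p)
    ≡⟨ regroup (d z) (form a p) ⟩
  2 * d z + form a p ∎
  where
  open ≡-Reasoning
  d = deg a p
  regroup : ∀ s t → s + (s + t) ≡ 2 * s + t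
  regroup = solve-∀
  flip-term : ∀ x → p x * a x z ≡ a z x * p x
  flip-term x = trans (*-comm (p x) (a x z)) (cong (_* p x) (a-sym x z))
  deg-q : ∀ x → deg a q x ≡ a x z + d x
  deg-q x = begin
    deg a q x
      ≡⟨ sum-cong-≗ (λ y → trans (cong (a x y *_) (q≡ y)) (trans (*-distribˡ-+ (a x y) (δ z y) (p y)) (cong (_+ a x y * p y) (*-comm (a x y) (δ z y))))) ⟩
    sum (λ y → δ z y * a x y + a x y * p y)
      ≡⟨ ∑-distrib-+ (λ y → δ z y * a x y) (λ y → a x y * p y) ⟩
    sum (λ y → δ z y * a x y) + d x
      ≡⟨ cong (_+ d x) (sum-δ z (a x)) ⟩
    a x z + d x ∎

-- Vertex subsets

Subset : ℕ → Set
Subset n = Fin n → Bool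

infix 4 _∈_ _∉_ _⊆_

_∈_ _∉_ : ∀ {n} → Fin n → Subset n → Set
x ∈ P = P x ≡ true
x ∉ P = P x ≡ false

_⊆_ : ∀ {n} → Subset n → Subset n → Set
P ⊆ Q = ∀ x → x ∈ P → x ∈ Q

ind : ∀ {n} → Subset n → Fin n → ℕ
ind P x = 𝟙 (P x)

size : ∀ {n} → Subset n → ℕ
size P = sum (ind P)

ind-mono : ∀ {n} (P Q : Subset n) → P ⊆ Q → ∀ x → ind P x ≤ ind Q x
ind-mono P Q P⊆Q x with P x in eq
... | true rewrite P⊆Q x eq = ≤-refl
... | false = z≤n

insert remove : ∀ {n} → Fin n → Subset n → Subset n
insert z P x = does (z ≟ x) ∨ P x
remove z P x = not (does (z ≟ x)) ∧ P x

ind-insert : ∀ {n} (P : Subset n) {z} → z ∉ P → ∀ x → ind (insert z P) x ≡ δ z x + ind P x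
ind-insert P {z} z∉P x with z ≟ x
... | yes refl rewrite z∉P = refl
... | no _ = refl

ind-remove : ∀ {n} (P : Subset n) {z} → z ∈ P → ∀ x → ind P x ≡ δ z x + ind (remove z P) x
ind-remove P {z} z∈P x with z ≟ x
... | yes refl rewrite z∈P = refl
... | no _ = refl

remove-⊆ : ∀ {n} (P : Subset n) z → remove z P ⊆ P
remove-⊆ P z x with z ≟ x
... | yes _ = λ ()
... | no _ = id

size-suc : ∀ {n} (P Q : Subset n) z → (∀ x → ind Q x ≡ δ z x + ind P x) → size Q ≡ suc (size P)
size-suc P Q z eq = begin
  _                        ≡⟨ sum-cong-≗ eq ⟩
  sum (λ x → δ z x + ind P x) ≡⟨ ∑-distrib-+ (δ z) (ind P) ⟩
  sum (δ z) + size P       ≡⟨ cong (_+ size P) (sum-cong-≗ λ x → sym (*-identityʳ (δ z x))) ⟩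
  sum (λ x → δ z x * 1) + size P ≡⟨ cong (_+ size P) (sum-δ z (λ _ → 1)) ⟩
  suc (size P) ∎
  where open ≡-Reasoning

-- Each deletion of a vertex of degree below K costs fewer than K edges, and form
-- counts every edge twice.
core : ∀ {n} {a : Fin n → Fin n → ℕ} → (∀ x y → a x y ≡ a y x) → (∀ x → a x x ≡ 0) →
       ∀ K m (P : Subset n) → size P ≡ m →
       ∃[ X ] X ⊆ P × (∀ x → x ∈ X → K ≤ deg a (ind X) x) ×
              form a (ind P) ≤ form a (ind X) + 2 * (K * m)
core {a = a} a-sym a-irr K m P eq
  with any? (λ z → (P z Bool.≟ true) ×-dec ¬? (K ≤? deg a (ind P) z))
... | no none = P , (λ _ → id)
      , (λ x x∈P → decidable-stable (K ≤? _) λ low → none (x , x∈P , low))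
      , m≤m+n _ _
core a-sym a-irr K zero P eq | yes (z , z∈P , low) =
  contradiction (trans (sym eq) (size-suc (remove z P) P z (ind-remove P z∈P))) λ ()
core {a = a} a-sym a-irr K (suc m) P eq | yes (z , z∈P , low) =
  let P′ = remove z P
      X , X⊆P′ , dense , bound =
        core a-sym a-irr K m P′ (suc-injective (trans (sym (size-suc P′ P z (ind-remove P z∈P))) eq))
      deg≤K : deg a (ind P′) z ≤ K
      deg≤K = ≤-trans (deg-mono a (ind-mono P′ P (remove-⊆ P z)) z) (<⇒≤ (≰⇒> low))
      open ≤-Reasoning
  in X , (λ x → remove-⊆ P z x ∘ X⊆P′ x) , dense , (begin
    form a (ind P)                                 ≡⟨ form-insert {p = ind P′} {z = z} a-sym (a-irr z) (ind-remove P z∈P) ⟩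
    2 * deg a (ind P′) z + form a (ind P′)         ≤⟨ +-mono-≤ (*-monoʳ-≤ 2 deg≤K) bound ⟩
    2 * K + (form a (ind X) + 2 * (K * m))         ≡⟨ regroup K m (form a (ind X)) ⟩
    form a (ind X) + 2 * (K * suc m)               ∎)
  where
  regroup : ∀ k m f → 2 * k + (f + 2 * (k * m)) ≡ f + 2 * (k * (1 + m))
  regroup = solve-∀

-- Pigeonhole by double counting: if every element of `Q` were a value of `f`, then `ind Q y` would
-- be at most the number of preimages of `y`, and these numbers sum to `v`.
outside-image : ∀ {v n} (f : Fin v → Fin n) (Q : Subset n) → v < size Q →
                ∃[ y ] y ∈ Q × (∀ x → f x ≢ y)
outside-image {v} f Q v<
  with any? (λ y → (Q y Bool.≟ true) ×-dec all? (λ x → ¬? (f x ≟ y)))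
... | yes found = found
... | no none = contradiction size≤v (<⇒≱ v<)
  where
  covered : ∀ y → ind Q y ≤ sum (λ x → δ (f x) y)
  covered y with Q y in y∈Q
  ... | false = z≤n
  ... | true with any? (λ x → f x ≟ y)
  ...   | no ¬hit = contradiction (y , y∈Q , λ x eq → ¬hit (x , eq)) none
  ...   | yes (x , eq) = ≤-trans (≤-reflexive (sym (cong 𝟙 (dec-true (f x ≟ y) eq)))) (term≤sum (λ x → δ (f x) y) x)
  size≤v : size Q ≤ v
  size≤v = begin
    size Q                             ≤⟨ sum-mono-≤ covered ⟩
    sum (λ y → sum (λ x → δ (f x) y))  ≡⟨ ∑-comm (λ y x → δ (f x) y) ⟩
    sum (λ x → sum (δ (f x)))          ≡⟨ sum-cong-≗ (λ x → trans (sum-cong-≗ λ y → sym (*-identityʳ (δ (f x) y))) (sum-δ (f x) (λ _ → 1))) ⟩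
    sum {v} (λ _ → 1)                  ≡⟨ sum-one v ⟩
    v                                  ∎
    where open ≤-Reasoning

∈-or-∉ : ∀ {n} (P : Subset n) x → x ∈ P ⊎ x ∉ P
∈-or-∉ P x with P x
... | true  = inj₁ refl
... | false = inj₂ refl

∈∉⇒≢ : ∀ {n} {P : Subset n} {x y} → x ∈ P → y ∉ P → x ≢ y
∈∉⇒≢ x∈P y∉P refl with () ← trans (sym x∈P) y∉P

here-insert : ∀ {n} (P : Subset n) z → z ∈ insert z P
here-insert P z = cong (_∨ P z) (dec-true (z ≟ z) refl)

there-insert : ∀ {n} (P : Subset n) z → P ⊆ insert z P
there-insert P z x x∈P = trans (cong (does (z ≟ x) ∨_) x∈P) (Bool.∨-zeroʳ _)

insert⁻ : ∀ {n} (P : Subset n) z x → x ∈ insert z P → x ≡ z ⊎ x ∈ P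
insert⁻ P z x with z ≟ x
... | yes refl = λ _ → inj₁ refl
... | no _ = inj₂

full-size : ∀ {n} (P : Subset n) → (∀ x → x ∈ P) → size P ≡ n
full-size {n} P all = trans (sum-cong-≗ (cong 𝟙 ∘ all)) (sum-one n)

size≤n : ∀ {n} (P : Subset n) → size P ≤ n
size≤n {n} P = ≤-trans (sum-mono-≤ (𝟙≤1 ∘ P)) (≤-reflexive (sum-one n))

-- Inserting a missing vertex would produce a subset of size n + 1.
size≡n⇒full : ∀ {n} (P : Subset n) → size P ≡ n → ∀ x → x ∈ P
size≡n⇒full {n} P eq x with ∈-or-∉ P x
... | inj₁ x∈P = x∈P
... | inj₂ x∉P = contradiction (size≤n (insert x P))
  (<⇒≱ (≤-reflexive (sym (trans (size-suc P (insert x P) x (ind-insert P x∉P)) (cong suc eq)))))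

size<n⇒∃∉ : ∀ {n} (P : Subset n) → size P < n → ∃[ x ] x ∉ P
size<n⇒∃∉ P lt with any? (λ x → P x Bool.≟ false)
... | yes found = found
... | no none = contradiction (full-size P everywhere) (<⇒≢ lt)
  where
  everywhere : ∀ x → x ∈ P
  everywhere x with ∈-or-∉ P x
  ... | inj₁ x∈P = x∈P
  ... | inj₂ x∉P = contradiction (x , x∉P) none

-- Paths and cycles

module _ {v} (E : Fin v → Fin v → Set) where

  -- The visited vertices are an index, and ℓ counts edges. A repetition-free path thus comes with a
  -- vector whose `lookup` is injective, which is the shape that `Cycle` asks for.
  data Path : Fin v → Fin v → ∀ {ℓ} → Vec (Fin v) (suc ℓ) → Set where
    stop : ∀ {x} → Path x x (x ∷ [])
    step : ∀ {x y z ℓ} {xs : Vec (Fin v) (suc ℓ)} → E x y → Path y z xs → Path x z (x ∷ xs)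

  SimplePath : Fin v → Fin v → Set
  SimplePath x y = ∃[ ℓ ] ∃[ xs ] (Path x y {ℓ} xs × Unique xs)

  suffix : ∀ {x y ℓ} {xs : Vec (Fin v) (suc ℓ)} → Path x y xs → Unique xs →
           ∀ i → SimplePath (lookup xs i) y
  suffix stop        u       zero    = _ , _ , stop , u
  suffix (step e p)  u       zero    = _ , _ , step e p , u
  suffix (step e p)  (_ ∷ u) (suc i) = suffix p u i

  -- Loop erasure: if the new first vertex already occurs on the simple path built from the rest,
  -- only the part from that occurrence on is kept.
  simplify : ∀ {x y} → Star E x y → SimplePath x y
  simplify ε = _ , _ , stop , [] ∷ []
  simplify {x} (e ◅ es) with simplify es
  ... | _ , xs , p , u with any? (λ i → lookup xs i ≟ x)
  ...   | yes (i , refl) = suffix p u i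
  ...   | no x∉xs = _ , _ , step e p , All-lookup⁻ (λ i eq → x∉xs (i , sym eq)) ∷ u

  path-first : ∀ {x y ℓ} {xs : Vec (Fin v) (suc ℓ)} → Path x y xs → lookup xs zero ≡ x
  path-first stop       = refl
  path-first (step _ _) = refl

  path-last : ∀ {x y ℓ} {xs : Vec (Fin v) (suc ℓ)} → Path x y xs → lookup xs (fromℕ ℓ) ≡ y
  path-last stop       = refl
  path-last (step _ p) = path-last p

  path-edge : ∀ {x y ℓ} {xs : Vec (Fin v) (suc ℓ)} → Path x y xs →
              ∀ i → E (lookup xs (inject₁ i)) (lookup xs (suc i))
  path-edge (step e p) zero    = subst (E _) (sym (path-first p)) e
  path-edge (step e p) (suc i) = path-edge p i

Adj-sym : ∀ {v} (G : Graph v) {x y} → Adj G x y → Adj G y x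
Adj-sym G {x} {y} = subst T (adj-sym G x y)

-- Adjacency in the subgraph induced on `P`; a walk along it cannot meet a vertex outside `P`.
Within : ∀ {v} → Graph v → Subset v → Fin v → Fin v → Set
Within G P x y = Adj G x y × x ∈ P × y ∈ P

Within-sym : ∀ {v} (G : Graph v) (P : Subset v) {x y} → Within G P x y → Within G P y x
Within-sym G P (xy , x∈P , y∈P) = Adj-sym G xy , y∈P , x∈P

path-within : ∀ {v} (G : Graph v) (P : Subset v) {x y ℓ} {xs : Vec (Fin v) (suc ℓ)} →
              x ∈ P → Path (Within G P) x y xs → ∀ i → lookup xs i ∈ P
path-within G P x∈P stop                     zero    = x∈P
path-within G P x∈P (step _ _)               zero    = x∈P
path-within G P x∈P (step (_ , _ , y∈P) p)   (suc i) = path-within G P y∈P p i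

close-cycle : ∀ {v} (G : Graph v) (P : Subset v) {u u′ w} → w ∉ P → u ∈ P → u ≢ u′ →
              Adj G u w → Adj G u′ w → SimplePath (Within G P) u u′ → Cycle G
close-cycle G P w∉P u∈P u≢u′ uw u′w (zero , _ , stop , _) = contradiction refl u≢u′
-- A path with m + 1 edges has m + 2 vertices, so together with `w` the cycle has m + 3.
close-cycle G P {u} {u′} {w} w∉P u∈P u≢u′ uw u′w (suc m , xs , p , uniq) = record
  { m     = m
  ; c     = lookup (w ∷ xs)
  ; c-inj = lookup-injective (All-lookup⁻ (λ i → ≢-sym (∈∉⇒≢ {P = P} (path-within G P u∈P p i) w∉P)) ∷ uniq) _ _
  ; step  = λ { zero    → subst (Adj G w) (sym (path-first _ p)) (Adj-sym G uw)
              ; (suc i) → proj₁ (path-edge _ p i) }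
  ; close = subst (λ x → Adj G x w) (sym (path-last _ p)) u′w
  }

-- Growing a tree vertex by vertex

-- The index counts edges, one fewer than the vertices. The last argument of `grow` makes `w` a leaf
-- of the enlarged subtree, so that each step creates exactly one edge.
data Growth {v} (G : Graph v) : ℕ → Subset v → Set where
  root : ∀ x → Growth G 0 (λ y → does (x ≟ y))
  grow : ∀ {i P} u w → Growth G i P → u ∈ P → w ∉ P → Adj G u w →
         (∀ u′ → u′ ∈ P → Adj G u′ w → u′ ≡ u) → Growth G (suc i) (insert w P)

module _ {v} {G : Graph v} where

  growth-size : ∀ {i P} → Growth G i P → size P ≡ suc i
  growth-size (root x) = trans (sum-cong-≗ λ y → sym (*-identityʳ (δ x y))) (sum-δ x (λ _ → 1))
  growth-size (grow {P = P} u w g _ w∉P _ _) =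
    trans (size-suc P (insert w P) w (ind-insert P w∉P)) (cong suc (growth-size g))

  growth-member : ∀ {i P} → Growth G i P → ∃[ x ] x ∈ P
  growth-member (root x) = x , dec-true (x ≟ x) refl
  growth-member (grow {P = P} u w _ _ _ _ _) = w , here-insert P w

  -- Any two vertices are joined through `u`, the attachment vertex of the latest leaf.
  growth-connected : ∀ {i P} → Growth G i P → ∀ x y → x ∈ P → y ∈ P → Star (Within G P) x y
  growth-connected (root r) x y x∈P y∈P with r ≟ x | r ≟ y
  ... | yes refl | yes refl = ε
  growth-connected {P = P′} (grow {P = P} u w g u∈P w∉P uw _) x y x∈P′ y∈P′ =
    to-u x x∈P′ ◅◅ reverse (Within-sym G P′) (to-u y y∈P′)
    where
    P⊆P′ = there-insert P w
    to-u : ∀ x → x ∈ P′ → Star (Within G P′) x u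
    to-u x x∈P′ with insert⁻ P w x x∈P′
    ... | inj₁ refl = (Adj-sym G uw , here-insert P w , P⊆P′ u u∈P) ◅ ε
    ... | inj₂ x∈P = gmap id (λ (xy , x∈P , y∈P) → xy , P⊆P′ _ x∈P , P⊆P′ _ y∈P)
                       (growth-connected g x u x∈P u∈P)

  crossing-edge : (P : Subset v) → ∀ {x y} → Star (Adj G) x y → x ∈ P → y ∉ P →
                  ∃[ u ] ∃[ w ] u ∈ P × w ∉ P × Adj G u w
  crossing-edge P ε x∈P y∉P = contradiction refl (∈∉⇒≢ {P = P} x∈P y∉P)
  crossing-edge P {x} (_◅_ {j = z} xz p) x∈P y∉P with ∈-or-∉ P z
  ... | inj₁ z∈P = crossing-edge P p z∈P y∉P
  ... | inj₂ z∉P = x , z , x∈P , z∉P , xz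

  growth-extend : IsTree G → ∀ {i P} → Growth G i P → suc i < v → ∃[ P′ ] Growth G (suc i) P′
  growth-extend ((_ , conn) , acyclic) {P = P} g lt
    with x , x∈P ← growth-member g
       | y , y∉P ← size<n⇒∃∉ P (subst (_< v) (sym (growth-size g)) lt)
    with u , w , u∈P , w∉P , uw ← crossing-edge P (conn x y) x∈P y∉P
    -- A second neighbour of `w` in `P` would be joined to `u` by a path inside `P`, and the two
    -- edges to `w` would close it to a cycle.
    = insert w P , grow u w g u∈P w∉P uw λ u′ u′∈P u′w → decidable-stable (u′ ≟ u) λ u′≢u →
        acyclic (close-cycle G P w∉P u∈P (≢-sym u′≢u) uw u′w
                   (simplify _ (growth-connected g u u′ u∈P u′∈P)))

  growth-of-length : IsTree G → ∀ i → i < v → ∃[ P ] Growth G i P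
  growth-of-length ((r , _) , _) zero _ = _ , root r
  growth-of-length tree (suc i) lt =
    growth-extend tree (proj₂ (growth-of-length tree i (<-trans (n<1+n i) lt))) lt

  spanning-growth : IsTree G → ∃[ i ] ∃[ P ] Growth G i P × (∀ x → x ∈ P)
  -- The vertex `r` supplied by connectedness shows that v is positive, so `v ∸ 1` is not truncated.
  spanning-growth tree@((r , _) , _) with growth-of-length tree (v ∸ 1) (pred< r)
    where
    pred< : ∀ {v} → Fin v → v ∸ 1 < v
    pred< {suc v} _ = n<1+n v
  ... | P , g = _ , P , g , size≡n⇒full P (trans (growth-size g) (suc-pred′ r))
    where
    suc-pred′ : ∀ {v} → Fin v → suc (v ∸ 1) ≡ v
    suc-pred′ {suc v} _ = refl

-- Greedy embedding

adjw : ∀ {n} → Graph n → Fin n → Fin n → ℕ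
adjw H x y = 𝟙 (adj H x y)

-- The adjacency matrix of those edges of `G` that `f` sends to edges of `H`; with `H` a colour
-- class, its form is twice the number of edges in that colour.
pullw : ∀ {v n} → Graph v → Graph n → (Fin v → Fin n) → Fin v → Fin v → ℕ
pullw G H f x y = 𝟙 (adj G x y ∧ adj H (f x) (f y))

adjw-sym : ∀ {n} (H : Graph n) x y → adjw H x y ≡ adjw H y x
adjw-sym H x y = cong 𝟙 (adj-sym H x y)

adjw-irr : ∀ {n} (H : Graph n) x → adjw H x x ≡ 0
adjw-irr H x = cong 𝟙 (adj-irr H x)

pullw-sym : ∀ {v n} (G : Graph v) (H : Graph n) f x y → pullw G H f x y ≡ pullw G H f y x
pullw-sym G H f x y = cong 𝟙 (cong₂ _∧_ (adj-sym G x y) (adj-sym H (f x) (f y)))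

pullw-irr : ∀ {v n} (G : Graph v) (H : Graph n) f x → pullw G H f x x ≡ 0
pullw-irr G H f x = cong (λ b → 𝟙 (b ∧ adj H (f x) (f x))) (adj-irr G x)

T⇒≡ : ∀ {b} → T b → b ≡ true
T⇒≡ = Equivalence.to Bool.T-≡

≡⇒T : ∀ {b} → b ≡ true → T b
≡⇒T = Equivalence.from Bool.T-≡

deg-leaf : ∀ {v} {a : Fin v → Fin v → ℕ} {P : Subset v} {u w} → u ∈ P →
           (∀ x → x ∈ P → x ≢ u → a w x ≡ 0) → deg a (ind P) w ≡ a w u
deg-leaf {a = a} {P} {u} {w} u∈P only = trans (sum-cong-≗ term) (sum-δ u (a w))
  where
  term : ∀ x → a w x * ind P x ≡ δ u x * a w x
  term x with u ≟ x | P x in x?P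
  ... | yes refl | true  = *-comm (a w x) 1
  ... | yes refl | false = contradiction refl (∈∉⇒≢ {P = P} u∈P x?P)
  ... | no u≢x   | true  = cong (_* 1) (only x x?P (≢-sym u≢x))
  ... | no u≢x   | false = *-zeroʳ (a w x)

form-singleton : ∀ {n} {a : Fin n → Fin n → ℕ} → (∀ x y → a x y ≡ a y x) → (∀ x → a x x ≡ 0) →
                 ∀ z → form a (δ z) ≡ 0
form-singleton {a = a} a-sym a-irr z = begin
  form a (δ z)  ≡⟨ sum-δ z (deg a (δ z)) ⟩
  deg a (δ z) z ≡⟨ sum-cong-≗ (λ y → *-comm (a z y) (δ z y)) ⟩
  sum (λ y → δ z y * a z y) ≡⟨ sum-δ z (a z) ⟩
  a z z         ≡⟨ a-irr z ⟩
  0             ∎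
  where open ≡-Reasoning

unique⇒nonadj : ∀ {v} (G : Graph v) {P : Subset v} {u w} →
                (∀ u′ → u′ ∈ P → Adj G u′ w → u′ ≡ u) →
                ∀ x → x ∈ P → x ≢ u → adj G w x ≡ false
unique⇒nonadj G {w = w} uniq x x∈P x≢u with adj G w x in wx
... | false = refl
... | true = contradiction (uniq x x∈P (Adj-sym G (≡⇒T wx))) x≢u

-- Every growth step contributes one edge, counted in both directions. For a spanning growth this
-- identifies the index with `e G`.
growth-form : ∀ {v} {G : Graph v} {i P} → Growth G i P → form (adjw G) (ind P) ≡ 2 * i
growth-form {G = G} (root x) = form-singleton (adjw-sym G) (adjw-irr G) x
growth-form {G = G} (grow {i} {P} u w g u∈P w∉P uw uniq) = begin
  form (adjw G) (ind (insert w P))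
    ≡⟨ form-insert {p = ind P} {z = w} (adjw-sym G) (adjw-irr G w) (ind-insert P w∉P) ⟩
  2 * deg (adjw G) (ind P) w + form (adjw G) (ind P)
    ≡⟨ cong₂ (λ s t → 2 * s + t)
         (trans (deg-leaf {a = adjw G} {P} u∈P λ x x∈P x≢u → cong 𝟙 (unique⇒nonadj G {P = P} uniq x x∈P x≢u))
                (cong 𝟙 (T⇒≡ (Adj-sym G uw))))
         (growth-form g) ⟩
  2 + 2 * i ≡⟨ *-suc 2 i ⟨
  2 * suc i ∎
  where open ≡-Reasoning

module _ {v n} {G : Graph v} {P : Subset v} {u w : Fin v} (u∈P : u ∈ P) (w∉P : w ∉ P)
         (uw : Adj G u w) (uniq : ∀ u′ → u′ ∈ P → Adj G u′ w → u′ ≡ u)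
         (f f′ : Fin v → Fin n) (f′≡f : ∀ x → x ∈ P → f′ x ≡ f x) where

  -- The leaf `w` has `u` as its only neighbour in `P`, so just the colour of the image of `uw`
  -- matters; pairs inside `P` keep their images because `f′` agrees with `f` there.
  form-extend : (H : Graph n) →
                form (pullw G H f′) (ind (insert w P)) ≡
                2 * 𝟙 (adj H (f u) (f′ w)) + form (pullw G H f) (ind P)
  form-extend H = trans
    (form-insert {p = ind P} {z = w} (pullw-sym G H f′) (pullw-irr G H f′ w) (ind-insert P w∉P))
    (cong₂ (λ s t → 2 * s + t)
      (trans (deg-leaf {a = pullw G H f′} {P} u∈P λ x x∈P x≢u →
                cong (λ b → 𝟙 (b ∧ adj H (f′ w) (f′ x))) (unique⇒nonadj G {P = P} uniq x x∈P x≢u))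
             (cong 𝟙 (trans (cong₂ _∧_ (T⇒≡ (Adj-sym G uw)) (cong (adj H (f′ w)) (f′≡f u u∈P)))
                            (adj-sym H (f′ w) (f u)))))
      (form-cong {a = pullw G H f′} {pullw G H f} {ind P} {ind P} same))
    where
    same : ∀ x y → ind P x * (pullw G H f′ x y * ind P y) ≡ ind P x * (pullw G H f x y * ind P y)
    same x y with P x in x?P | P y in y?P
    ... | false | _     = refl
    ... | true  | false = cong (1 *_) (trans (*-zeroʳ (pullw G H f′ x y)) (sym (*-zeroʳ (pullw G H f x y))))
    ... | true  | true  = cong₂ (λ s t → 1 * (𝟙 (adj G x y ∧ adj H s t) * 1)) (f′≡f x x?P) (f′≡f y y?P)

Inj-on : ∀ {v n} → Subset v → (Fin v → Fin n) → Set
Inj-on P f = ∀ x y → x ∈ P → y ∈ P → f x ≡ f y → x ≡ y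

-- More than v neighbours inside `X`: a map from the v tree vertices cannot occupy all of them.
Dense : ∀ {n} → ℕ → Graph n → Subset n → Set
Dense v H X = ∀ x → x ∈ X → v < deg (adjw H) (ind X) x

∧-true : ∀ {a b} → a ∧ b ≡ true → a ≡ true × b ≡ true
∧-true {true} {true} _ = refl , refl

fresh-neighbour : ∀ {v n} {H : Graph n} {X : Subset n} → Dense v H X → (f : Fin v → Fin n) →
                  ∀ x → x ∈ X → ∃[ y ] adj H x y ≡ true × y ∈ X × (∀ z → f z ≢ y)
fresh-neighbour {H = H} {X} dense f x x∈X
  with y , xy∧y∈X , fresh ← outside-image f (λ y → adj H x y ∧ X y)
         (≤-trans (dense x x∈X) (≤-reflexive (sum-cong-≗ λ y → sym (𝟙-∧ (adj H x y) (X y)))))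
  with xy , y∈X ← ∧-true xy∧y∈X = y , xy , y∈X , fresh

module _ {v n} (G : Graph v) (χ : TwoColoring n) {X Y : Subset n} (X⊆Y : X ⊆ Y)
         (X-dense : Dense v (R χ) X) (Y-dense : Dense v (B χ) Y) (r : ℕ) where

  -- Invariant after i tree edges: the first r of them are red and the others blue, whence `i ⊓ r`
  -- and `i ∸ r`. `f` is total, but only its values on `P` are meaningful, so injectivity is claimed
  -- only there.
  record Embedded (i : ℕ) (P : Subset v) : Set where
    field
      f    : Fin v → Fin n
      inj  : Inj-on P f
      in-X : i ≤ r → ∀ x → x ∈ P → f x ∈ X
      in-Y : ∀ x → x ∈ P → f x ∈ Y
      red  : form (pullw G (R χ) f) (ind P) ≡ 2 * (i ⊓ r)
      blue : form (pullw G (B χ) f) (ind P) ≡ 2 * (i ∸ r)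

  embed : ∀ {x₀} → x₀ ∈ X → ∀ {i P} → Growth G i P → Embedded i P
  embed {x₀} x₀∈X (root x) = record
    -- The value `x₀` is also the placeholder for vertices not yet placed; fresh neighbours avoid
    -- placeholders as well.
    { f    = λ _ → x₀
    ; inj  = λ y z y∈ z∈ _ → trans (sym (single y y∈)) (single z z∈)
    ; in-X = λ _ _ _ → x₀∈X
    ; in-Y = λ _ _ → X⊆Y x₀ x₀∈X
    ; red  = form-singleton (pullw-sym G (R χ) _) (pullw-irr G (R χ) λ _ → x₀) x
    ; blue = trans (form-singleton (pullw-sym G (B χ) _) (pullw-irr G (B χ) λ _ → x₀) x)
                   (cong (2 *_) (sym (0∸n≡0 r)))
    }
    where
    single : ∀ y → does (x ≟ y) ≡ true → x ≡ y
    single y with x ≟ y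
    ... | yes eq = λ _ → eq
    ... | no _   = λ ()
  embed x₀∈X (grow {i} {P} u w g u∈P w∉P uw uniq) = extend (i <? r)
    where
    open Embedded (embed x₀∈X g)

    module Place (y : Fin n) (fresh : ∀ z → f z ≢ y) where
      f′ : Fin v → Fin n
      f′ = updateAt f w (const y)

      f′w : f′ w ≡ y
      f′w = updateAt-updates w f

      f′≡f : ∀ x → x ∈ P → f′ x ≡ f x
      f′≡f x x∈P = updateAt-minimal x w f (∈∉⇒≢ {P = P} x∈P w∉P)

      inj′ : Inj-on (insert w P) f′
      inj′ a b a∈ b∈ eq with insert⁻ P w a a∈ | insert⁻ P w b b∈
      ... | inj₁ refl | inj₁ refl = refl
      ... | inj₁ refl | inj₂ b∈P  = contradiction (trans (sym (f′≡f b b∈P)) (trans (sym eq) f′w)) (fresh b)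
      ... | inj₂ a∈P  | inj₁ refl = contradiction (trans (sym (f′≡f a a∈P)) (trans eq f′w)) (fresh a)
      ... | inj₂ a∈P  | inj₂ b∈P  = inj a b a∈P b∈P (trans (sym (f′≡f a a∈P)) (trans eq (f′≡f b b∈P)))

      maps-into : ∀ {Z : Subset n} → y ∈ Z → (∀ x → x ∈ P → f x ∈ Z) → ∀ x → x ∈ insert w P → f′ x ∈ Z
      maps-into {Z} y∈Z old x x∈ with insert⁻ P w x x∈
      ... | inj₁ refl = trans (cong Z f′w) y∈Z
      ... | inj₂ x∈P  = trans (cong Z (f′≡f x x∈P)) (old x x∈P)

      count : ∀ (H : Graph n) k {b} → adj H (f u) y ≡ b → form (pullw G H f) (ind P) ≡ 2 * k →
              form (pullw G H f′) (ind (insert w P)) ≡ 2 * (𝟙 b + k)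
      count H k {b} fuy old = begin
        form (pullw G H f′) (ind (insert w P))
          ≡⟨ form-extend {G = G} {P = P} u∈P w∉P uw uniq f f′ f′≡f H ⟩
        2 * 𝟙 (adj H (f u) (f′ w)) + form (pullw G H f) (ind P)
          ≡⟨ cong₂ (λ s t → 2 * 𝟙 s + t) (trans (cong (adj H (f u)) f′w) fuy) old ⟩
        2 * 𝟙 b + 2 * k
          ≡⟨ *-distribˡ-+ 2 (𝟙 b) k ⟨
        2 * (𝟙 b + k) ∎
        where open ≡-Reasoning

    extend : Dec (i < r) → Embedded (suc i) (insert w P)
    extend (yes i<r)
      with y , fuy , y∈X , fresh ← fresh-neighbour {H = R χ} {X} X-dense f (f u) (in-X (<⇒≤ i<r) u u∈P) = record
      { f    = f′
      ; inj  = inj′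
      ; in-X = λ _ → maps-into y∈X (in-X (<⇒≤ i<r))
      ; in-Y = maps-into (X⊆Y y y∈X) in-Y
      ; red  = trans (count (R χ) (i ⊓ r) fuy red) (cong (2 *_) (trans (cong suc (m≤n⇒m⊓n≡m (<⇒≤ i<r))) (sym (m≤n⇒m⊓n≡m i<r))))
      -- Freshness gives `f u ≢ y`, so `partition` applies and the new red edge is not blue.
      ; blue = trans (count (B χ) (i ∸ r) (trans (partition χ (fresh u)) (cong not fuy)) blue)
                     (cong (2 *_) (trans (m≤n⇒m∸n≡0 (<⇒≤ i<r)) (sym (m≤n⇒m∸n≡0 i<r))))
      }
      where open Place y fresh
    extend (no i≮r)
      with y , fuy , y∈Y , fresh ← fresh-neighbour {H = B χ} {Y} Y-dense f (f u) (in-Y u u∈P) = record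
      { f    = f′
      ; inj  = inj′
      -- From the first blue edge on, the premise `suc i ≤ r` fails, so the embedding may leave `X`.
      ; in-X = λ i<r → contradiction i<r i≮r
      ; in-Y = maps-into y∈Y in-Y
      ; red  = trans (count (R χ) (i ⊓ r) (Bool.not-injective (trans (sym (partition χ (fresh u))) fuy)) red)
                     (cong (2 *_) (trans (m≥n⇒m⊓n≡n r≤i) (sym (m≥n⇒m⊓n≡n (m≤n⇒m≤1+n r≤i)))))
      ; blue = trans (count (B χ) (i ∸ r) fuy blue) (cong (2 *_) (sym (+-∸-assoc 1 r≤i)))
      }
      where
      open Place y fresh
      r≤i = ≮⇒≥ i≮r

-- Edge counts as forms

module _ {A : Set} where

  length≡total : (xs : List A) → length xs ≡ total (map (λ _ → 1) xs)
  length≡total []       = refl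
  length≡total (x ∷ xs) = cong suc (length≡total xs)

  total-filter : ∀ {P : A → Set} (P? : ∀ x → Dec (P x)) (g : A → ℕ) xs →
                 total (map g (filter P? xs)) ≡ total (map (λ x → 𝟙 (does (P? x)) * g x) xs)
  total-filter P? g [] = refl
  total-filter P? g (x ∷ xs) with does (P? x)
  ... | true  = cong₂ _+_ (sym (+-identityʳ (g x))) (total-filter P? g xs)
  ... | false = total-filter P? g xs

  length-filter : ∀ {P : A → Set} (P? : ∀ x → Dec (P x)) xs →
                  length (filter P? xs) ≡ total (map (λ x → 𝟙 (does (P? x))) xs)
  length-filter P? [] = refl
  length-filter P? (x ∷ xs) with does (P? x)
  ... | true  = cong suc (length-filter P? xs)
  ... | false = length-filter P? xs

total-product : ∀ {A B : Set} (g : A × B → ℕ) xs ys →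
                total (map g (cartesianProduct xs ys)) ≡ total (map (λ x → total (map (λ y → g (x , y)) ys)) xs)
total-product g []       ys = refl
total-product g (x ∷ xs) ys = begin
  total (map g (map (x ,_) ys ++ cartesianProduct xs ys))
    ≡⟨ cong total (map-++ g (map (x ,_) ys) _) ⟩
  total (map g (map (x ,_) ys) ++ map g (cartesianProduct xs ys))
    ≡⟨ sum-++ (map g (map (x ,_) ys)) _ ⟩
  total (map g (map (x ,_) ys)) + total (map g (cartesianProduct xs ys))
    ≡⟨ cong₂ _+_ (cong total (sym (map-∘ ys))) (total-product g xs ys) ⟩
  _ ∎
  where open ≡-Reasoning

total-tabulate : ∀ {n} {A : Set} (g : A → ℕ) (h : Fin n → A) → total (map g (tabulate h)) ≡ sum (g ∘ h)
total-tabulate {zero}  g h = refl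
total-tabulate {suc n} g h = cong (g (h zero) +_) (total-tabulate g (h ∘ suc))

below : ∀ {n} → Fin n → Fin n → ℕ
below x y = 𝟙 (does (x <ꟳ? y))

-- Turns filtering into multiplication by 0/1 weights, so that sums over the edge list become double
-- sums over `Fin v`.
total-edges : ∀ {v} (G : Graph v) (g : Fin v × Fin v → ℕ) →
              total (map g (edges G)) ≡ sum λ x → sum λ y → below x y * (adjw G x y * g (x , y))
total-edges {v} G g = begin
  total (map g (edges G))
    ≡⟨ total-filter (λ (x , y) → (x <ꟳ? y) ×-dec Bool.T? (adj G x y)) g pairs ⟩
  total (map w pairs)
    ≡⟨ total-product w (allFin v) (allFin v) ⟩
  total (map (λ x → row x (allFin v)) (allFin v))
    ≡⟨ total-tabulate (λ x → row x (allFin v)) id ⟩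
  sum (λ x → row x (allFin v))
    ≡⟨ sum-cong-≗ (λ x → total-tabulate (λ y → w (x , y)) id) ⟩
  sum (λ x → sum λ y → w (x , y))
    ≡⟨ sum-cong-≗ (λ x → sum-cong-≗ λ y → trans
         (cong (_* g (x , y)) (𝟙-∧ (does (x <ꟳ? y)) (adj G x y)))
         (*-assoc (below x y) (adjw G x y) (g (x , y)))) ⟩
  sum (λ x → sum λ y → below x y * (adjw G x y * g (x , y))) ∎
  where
  open ≡-Reasoning
  pairs = cartesianProduct (allFin v) (allFin v)
  w : Fin v × Fin v → ℕ
  w (x , y) = 𝟙 (does (x <ꟳ? y) ∧ adj G x y) * g (x , y)
  row : Fin v → List (Fin v) → ℕ
  row x ys = total (map (λ y → w (x , y)) ys)

ones : ∀ {n} → Fin n → ℕ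
ones _ = 1

-- Trichotomy sorts the ordered pairs: the diagonal contributes 0, and exchanging the summations
-- identifies the pairs with x > y with those with x < y.
form-ones : ∀ {n} {a : Fin n → Fin n → ℕ} → (∀ x y → a x y ≡ a y x) → (∀ x → a x x ≡ 0) →
            form a ones ≡ 2 * sum λ x → sum λ y → below x y * a x y
form-ones {n} {a} a-sym a-irr = begin
  form a ones
    ≡⟨ sum-cong-≗ (λ x → trans (*-identityˡ (deg a ones x)) (sum-cong-≗ (split x))) ⟩
  sum (λ x → sum λ y → up x y + up y x)
    ≡⟨ sum-cong-≗ (λ x → ∑-distrib-+ (up x) (λ y → up y x)) ⟩
  sum (λ x → sum (up x) + sum λ y → up y x)
    ≡⟨ ∑-distrib-+ (λ x → sum (up x)) (λ x → sum λ y → up y x) ⟩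
  sum (λ x → sum (up x)) + sum (λ x → sum λ y → up y x)
    ≡⟨ cong (sum (λ x → sum (up x)) +_) (trans (∑-comm (λ x y → up y x)) (sym (+-identityʳ _))) ⟩
  2 * sum (λ x → sum (up x)) ∎
  where
  open ≡-Reasoning
  up : Fin n → Fin n → ℕ
  up x y = below x y * a x y
  split : ∀ x y → a x y * 1 ≡ up x y + up y x
  split x y with <-cmp x y
  ... | tri≈ _ refl _ rewrite a-irr x | *-zeroʳ (below x x) = refl
  ... | tri< x<y _ y≮x rewrite dec-true (x <ꟳ? y) x<y | dec-false (y <ꟳ? x) y≮x = trans (*-identityʳ (a x y)) (lemma (a x y))
    where
    lemma : ∀ t → t ≡ 1 * t + 0
    lemma = solve-∀
  ... | tri> x≮y _ y<x rewrite dec-false (x <ꟳ? y) x≮y | dec-true (y <ꟳ? x) y<x =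
    trans (*-identityʳ (a x y)) (trans (a-sym x y) (sym (*-identityˡ (a y x))))

2e≡form : ∀ {v} (G : Graph v) → 2 * e G ≡ form (adjw G) ones
2e≡form G = trans
  (cong (2 *_) (trans (length≡total (edges G)) (trans (total-edges G (λ _ → 1))
    (sum-cong-≗ λ x → sum-cong-≗ λ y → cong (below x y *_) (*-identityʳ (adjw G x y))))))
  (sym (form-ones (adjw-sym G) (adjw-irr G)))

2edgesInto≡form : ∀ {v n} (G : Graph v) (H : Graph n) f → 2 * edgesInto G H f ≡ form (pullw G H f) ones
2edgesInto≡form G H f = trans
  (cong (2 *_) (trans (length-filter (λ (x , y) → Bool.T? (adj H (f x) (f y))) (edges G))
    (trans (total-edges G (λ (x , y) → 𝟙 (adj H (f x) (f y))))
      (sum-cong-≗ λ x → sum-cong-≗ λ y → cong (below x y *_) (sym (𝟙-∧ (adj G x y) (adj H (f x) (f y))))))))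
  (sym (form-ones (pullw-sym G H f) (pullw-irr G H f)))

form-full : ∀ {n} (a : Fin n → Fin n → ℕ) (P : Subset n) → (∀ x → x ∈ P) → form a (ind P) ≡ form a ones
form-full a P full = form-cong {a = a} {a} {ind P} {ones} λ x y →
  cong₂ (λ s t → 𝟙 s * (a x y * 𝟙 t)) (full x) (full y)

-- Colourings with a dense red core inside the blue core

swap : ∀ {n} → TwoColoring n → TwoColoring n
swap χ = record
  { R = B χ
  ; B = R χ
  ; partition = λ x≢y → trans (sym (Bool.not-involutive _)) (cong not (sym (partition χ x≢y)))
  }

copy-unswap : ∀ {v n} {G : Graph v} {χ : TwoColoring n} {r b} → ColoredCopy G (swap χ) b r → ColoredCopy G χ r b
copy-unswap (f , inj , blue , red) = f , inj , red , blue

module _ {v n} {G : Graph v} (tree : IsTree G) (χ : TwoColoring n) where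

  -- A spanning growth has `e G` = r + b edges, so the embedding invariant for it reads r red and b
  -- blue edges once the doubled counts are cancelled.
  copy-from-cores : ∀ {X Y : Subset n} {x₀} → X ⊆ Y → Dense v (R χ) X → Dense v (B χ) Y → x₀ ∈ X →
                    ∀ r b → r + b ≡ e G → ColoredCopy G χ r b
  copy-from-cores X⊆Y X-dense Y-dense x₀∈X r b r+b≡e
    with i , P , g , full ← spanning-growth tree =
    f , (λ {x} {y} → inj x y (full x) (full y))
      , *-cancelˡ-≡ _ _ 2 (trans (2edgesInto≡form G (R χ) f) (trans (sym (form-full (pullw G (R χ) f) P full)) (trans red
          (cong (2 *_) (trans (cong (_⊓ r) i≡r+b) (m≥n⇒m⊓n≡n (m≤m+n r b)))))))
      , *-cancelˡ-≡ _ _ 2 (trans (2edgesInto≡form G (B χ) f) (trans (sym (form-full (pullw G (B χ) f) P full)) (trans blue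
          (cong (2 *_) (trans (cong (_∸ r) i≡r+b) (m+n∸m≡n r b))))))
    where
    open Embedded (embed G χ X⊆Y X-dense Y-dense r x₀∈X g)
    i≡r+b : i ≡ r + b
    i≡r+b = trans (*-cancelˡ-≡ _ _ 2 (trans (sym (growth-form g)) (trans (form-full (adjw G) P full) (sym (2e≡form G)))))
                  (sym r+b≡e)

  -- The alternatives are whether the red core `X` of the blue core `Y` is nonempty. If it is empty,
  -- the bound on the edges lost in peeling already bounds all red edges inside `Y`.
  copy-or-sparse-core :
    (∀ r b → r + b ≡ e G → ColoredCopy G χ r b) ⊎
    ∃[ Y ] form (adjw (R χ)) (ind Y) ≤ 2 * (suc v * n) ×
           form (adjw (B χ)) ones ≤ form (adjw (B χ)) (ind Y) + 2 * (suc v * n)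
  copy-or-sparse-core
    -- With K = v + 1 the degree bound of `core` is `Dense v` by definition.
    with Y , _ , Y-dense , Y-bound ← core (adjw-sym (B χ)) (adjw-irr (B χ)) (suc v) n (λ _ → true) (full-size _ λ _ → refl)
    with X , X⊆Y , X-dense , X-bound ← core (adjw-sym (R χ)) (adjw-irr (R χ)) (suc v) (size Y) Y refl
    with any? (λ x → X x Bool.≟ true)
  ... | yes (x₀ , x₀∈X) = inj₁ (copy-from-cores X⊆Y X-dense Y-dense x₀∈X)
  ... | no empty = inj₂ (Y , (begin
      form (adjw (R χ)) (ind Y)                             ≤⟨ X-bound ⟩
      form (adjw (R χ)) (ind X) + 2 * (suc v * size Y)      ≡⟨ cong (_+ 2 * (suc v * size Y)) (sum-zero λ x → cong (_* deg (adjw (R χ)) (ind X) x) (empty′ x)) ⟩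
      2 * (suc v * size Y)                                  ≤⟨ *-monoʳ-≤ 2 (*-monoʳ-≤ (suc v) (size≤n Y)) ⟩
      2 * (suc v * n)                                       ∎)
      , Y-bound)
    where
    open ≤-Reasoning
    empty′ : ∀ x → ind X x ≡ 0
    empty′ x with ∈-or-∉ X x
    ... | inj₁ x∈X = contradiction (x , x∈X) empty
    ... | inj₂ x∉X = cong 𝟙 x∉X

-- Two sparse cores contradict balance

form≤size² : ∀ {n} (H : Graph n) (P : Subset n) → form (adjw H) (ind P) ≤ size P * size P
form≤size² H P = ≤-trans (form-weight-mono (ind P) λ x y → 𝟙≤1 (adj H x y)) (≤-reflexive (form-one (ind P)))

-- Each ordered pair from `P` is red, blue or diagonal, and the diagonal accounts for `size P`.
size²≤forms : ∀ {n} (χ : TwoColoring n) (P : Subset n) →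
              size P * size P ≤ size P + (form (adjw (R χ)) (ind P) + form (adjw (B χ)) (ind P))
size²≤forms χ P = begin
  size P * size P ≡⟨ form-one (ind P) ⟨
  form (λ _ _ → 1) (ind P) ≤⟨ form-weight-mono (ind P) cover ⟩
  form (λ x y → δ x y + (adjw (R χ) x y + adjw (B χ) x y)) (ind P)
    ≡⟨ form-+ δ (λ x y → adjw (R χ) x y + adjw (B χ) x y) (ind P) ⟩
  form δ (ind P) + form (λ x y → adjw (R χ) x y + adjw (B χ) x y) (ind P)
    ≡⟨ cong₂ _+_ (trans (form-δ (ind P)) (sum-cong-≗ λ x → idem (P x))) (form-+ (adjw (R χ)) (adjw (B χ)) (ind P)) ⟩
  size P + (form (adjw (R χ)) (ind P) + form (adjw (B χ)) (ind P)) ∎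
  where
  open ≤-Reasoning
  idem : ∀ b → 𝟙 b * 𝟙 b ≡ 𝟙 b
  idem true  = refl
  idem false = refl
  excluded-middle : ∀ b → 1 ≤ 𝟙 b + 𝟙 (not b)
  excluded-middle true  = ≤-refl
  excluded-middle false = ≤-refl
  cover : ∀ x y → 1 ≤ δ x y + (adjw (R χ) x y + adjw (B χ) x y)
  cover x y with x ≟ y
  ... | yes _ = s≤s z≤n
  ... | no x≢y rewrite partition χ x≢y = excluded-middle (adj (R χ) x y)

_∩_ : ∀ {n} → Subset n → Subset n → Subset n
(P ∩ Q) x = P x ∧ Q x

∩-⊆ˡ : ∀ {n} (P Q : Subset n) → P ∩ Q ⊆ P
∩-⊆ˡ P Q x = proj₁ ∘ ∧-true

∩-⊆ʳ : ∀ {n} (P Q : Subset n) → P ∩ Q ⊆ Q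
∩-⊆ʳ P Q x = proj₂ ∘ ∧-true {P x}

size-∩ : ∀ {n} (P Q : Subset n) → size P + size Q ≤ n + size (P ∩ Q)
size-∩ {n} P Q = begin
  size P + size Q                   ≡⟨ ∑-distrib-+ (ind P) (ind Q) ⟨
  sum (λ x → ind P x + ind Q x)     ≤⟨ sum-mono-≤ (λ x → meet (P x) (Q x)) ⟩
  sum (λ x → 1 + ind (P ∩ Q) x)     ≡⟨ ∑-distrib-+ ones (ind (P ∩ Q)) ⟩
  sum {n} ones + size (P ∩ Q)       ≡⟨ cong (_+ size (P ∩ Q)) (sum-one n) ⟩
  n + size (P ∩ Q)                  ∎
  where
  open ≤-Reasoning
  meet : ∀ a b → 𝟙 a + 𝟙 b ≤ 1 + 𝟙 (a ∧ b)
  meet true  b = ≤-refl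
  meet false b = ≤-trans (𝟙≤1 b) (m≤m+n 1 0)

-- Each core spans about half of all pairs, so it has about n/√2 > 3n/5 vertices.
three-fifths : ∀ {c n y} → 25 * c < n → n * n ≤ 2 * (y * y) + c * n → 3 * n ≤ 5 * y
three-fifths {c} {n} {y} big bound = ≮⇒≥ λ 5y<3n → <⇒≱ (gap n big) (begin
  25 * (n * n)                                  ≤⟨ *-monoʳ-≤ 25 bound ⟩
  25 * (2 * (y * y) + c * n)                    ≡⟨ expand y c n ⟩
  2 * ((5 * y) * (5 * y)) + 25 * c * n          ≤⟨ +-mono-≤ (*-monoʳ-≤ 2 (*-mono-≤ (<⇒≤ 5y<3n) (<⇒≤ 5y<3n))) (*-monoˡ-≤ n (<⇒≤ big)) ⟩
  2 * ((3 * n) * (3 * n)) + n * n               ≡⟨ collect n ⟩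
  19 * (n * n)                                  ∎)
  where
  open ≤-Reasoning
  expand : ∀ y c n → 25 * (2 * (y * y) + c * n) ≡ 2 * ((5 * y) * (5 * y)) + 25 * c * n
  expand = solve-∀
  collect : ∀ n → 2 * ((3 * n) * (3 * n)) + n * n ≡ 19 * (n * n)
  collect = solve-∀
  gap : ∀ n → 25 * c < n → 19 * (n * n) < 25 * (n * n)
  gap (suc n) _ = *-monoˡ-< (suc n * suc n) (m≤m+n 20 5)

-- Two sets of at least 3n/5 vertices overlap in z ≥ n/5 of them. Then z² ≥ n²/25, which exceeds cn
-- as soon as n > 25c; this is where the factor 25 comes from.
cores-too-large : ∀ {c n y y′ z} → 25 * c < n →
                  n * n ≤ 2 * (y * y) + c * n → n * n ≤ 2 * (y′ * y′) + c * n →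
                  z * z ≤ c * n → ¬ (y + y′ ≤ n + z)
cores-too-large {c} {n} {y} {y′} {z} big y-bound y′-bound z-bound meet = <-irrefl refl (begin-strict
  n * n                  ≤⟨ *-mono-≤ n≤5z n≤5z ⟩
  (5 * z) * (5 * z)      ≡⟨ square z ⟩
  25 * (z * z)           ≤⟨ *-monoʳ-≤ 25 z-bound ⟩
  25 * (c * n)           ≡⟨ *-assoc 25 c n ⟨
  25 * c * n             <⟨ scale-n n big ⟩
  n * n                  ∎)
  where
  open ≤-Reasoning
  square : ∀ z → (5 * z) * (5 * z) ≡ 25 * (z * z)
  square = solve-∀
  scale-n : ∀ n → 25 * c < n → 25 * c * n < n * n
  scale-n (suc n) lt = *-monoˡ-< (suc n) lt
  double : ∀ n → 5 * n + n ≡ 3 * n + 3 * n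
  double = solve-∀
  n≤5z : n ≤ 5 * z
  n≤5z = +-cancelˡ-≤ (5 * n) n (5 * z) (begin
    5 * n + n         ≡⟨ double n ⟩
    3 * n + 3 * n     ≤⟨ +-mono-≤ (three-fifths {c} {y = y} big y-bound) (three-fifths {c} {y = y′} big y′-bound) ⟩
    5 * y + 5 * y′    ≡⟨ *-distribˡ-+ 5 y y′ ⟨
    5 * (y + y′)      ≤⟨ *-monoʳ-≤ 5 meet ⟩
    5 * (n + z)       ≡⟨ *-distribˡ-+ 5 n z ⟩
    5 * n + 5 * z     ∎)

2*nC2 : ∀ n → 2 * (n C 2) + n ≡ n * n
2*nC2 zero    = refl
2*nC2 (suc n) = begin
  2 * (suc n C 2) + suc n           ≡⟨ cong (λ t → 2 * t + suc n) (nCk+nC[k+1]≡[n+1]C[k+1] n 1) ⟨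
  2 * (n C 1 + n C 2) + suc n       ≡⟨ cong (λ t → 2 * (t + n C 2) + suc n) (nC1≡n n) ⟩
  2 * (n + n C 2) + suc n           ≡⟨ regroup n (n C 2) ⟩
  (2 * (n C 2) + n) + (2 * n + 1)   ≡⟨ cong (_+ (2 * n + 1)) (2*nC2 n) ⟩
  n * n + (2 * n + 1)               ≡⟨ square n ⟩
  suc n * suc n                     ∎
  where
  open ≡-Reasoning
  regroup : ∀ n t → 2 * (n + t) + (1 + n) ≡ (2 * t + n) + (2 * n + 1)
  regroup = solve-∀
  square : ∀ n → n * n + (2 * n + 1) ≡ (1 + n) * (1 + n)
  square = solve-∀

-- Halving with rounding down loses at most 1, which doubling turns into the summand 2; the summand
-- n is the diagonal of n².
half-bound : ∀ {n} (H : Graph n) → (n C 2) / 2 ≤ e H → n * n ≤ 2 * form (adjw H) ones + (n + 2)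
half-bound {n} H h≤e = begin
  n * n                                             ≡⟨ 2*nC2 n ⟨
  2 * (n C 2) + n                                   ≡⟨ cong (λ t → 2 * t + n) (m≡m%n+[m/n]*n (n C 2) 2) ⟩
  2 * ((n C 2) % 2 + (n C 2) / 2 * 2) + n           ≤⟨ +-monoˡ-≤ n (*-monoʳ-≤ 2 (+-mono-≤ (≤-pred (m%n<n (n C 2) 2)) (*-monoˡ-≤ 2 h≤e))) ⟩
  2 * (1 + e H * 2) + n                             ≡⟨ regroup (e H) n ⟩
  2 * (2 * e H) + (n + 2)                           ≡⟨ cong (λ t → 2 * t + (n + 2)) (2e≡form H) ⟩
  2 * form (adjw H) ones + (n + 2)                  ∎
  where
  open ≤-Reasoning
  regroup : ∀ t n → 2 * (1 + t * 2) + n ≡ 2 * (2 * t) + (n + 2)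
  regroup = solve-∀

-- One linear coefficient for both estimates fed to `cores-too-large`. With k = v + 1, the core
-- sizes cost 4k from peeling and 3 from n + 2 ≤ 3n, while the intersection costs 4k + 1, rounded up
-- to match.
slack : ℕ → ℕ
slack v = 4 * suc v + 3

-- A colour class with half the edges has form about n²/2. Peeling loses only O(n) of it, and what
-- survives is at most the square of the size of `Y`.
core-size-bound : ∀ {n v} (H : Graph n) (Y : Subset n) → 1 ≤ n → (n C 2) / 2 ≤ e H →
                  form (adjw H) ones ≤ form (adjw H) (ind Y) + 2 * (suc v * n) →
                  n * n ≤ 2 * (size Y * size Y) + slack v * n
core-size-bound {n} {v} H Y 1≤n h≤e bound = begin
  n * n
    ≤⟨ half-bound H h≤e ⟩
  2 * form (adjw H) ones + (n + 2)
    ≤⟨ +-mono-≤ (*-monoʳ-≤ 2 (≤-trans bound (+-monoˡ-≤ _ (form≤size² H Y)))) (+-monoʳ-≤ n (*-monoʳ-≤ 2 1≤n)) ⟩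
  2 * (size Y * size Y + 2 * (suc v * n)) + (n + 2 * n)
    ≡⟨ regroup (size Y) (suc v) n ⟩
  2 * (size Y * size Y) + slack v * n ∎
  where
  open ≤-Reasoning
  regroup : ∀ y k n → 2 * (y * y + 2 * (k * n)) + (n + 2 * n) ≡ 2 * (y * y) + (4 * k + 3) * n
  regroup = solve-∀

balanced⇒copies : ∀ {v n} {G : Graph v} → IsTree G → 25 * slack v < n → (χ : TwoColoring n) →
                  (n C 2) / 2 ≤ e (R χ) → (n C 2) / 2 ≤ e (B χ) →
                  ∀ r b → r + b ≡ e G → ColoredCopy G χ r b
balanced⇒copies {v} {n} {G} tree big χ red-half blue-half r b r+b≡e
  with copy-or-sparse-core tree χ | copy-or-sparse-core tree (swap χ)
... | inj₁ copies | _ = copies r b r+b≡e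
... | inj₂ _ | inj₁ copies = copy-unswap {G = G} {χ} (copies b r (trans (+-comm b r) r+b≡e))
-- `Y` has few red edges and `Y′`, found after swapping colours, few blue ones, so both colours are
-- sparse on the intersection.
... | inj₂ (Y , Y-sparse , Y-bound) | inj₂ (Y′ , Y′-sparse , Y′-bound) =
  contradiction (size-∩ Y Y′) (cores-too-large {slack v} {y = size Y} {size Y′} big
    (core-size-bound {v = v} (B χ) Y 1≤n blue-half Y-bound)
    (core-size-bound {v = v} (R χ) Y′ 1≤n red-half Y′-bound)
    (begin
      size Z * size Z
        ≤⟨ size²≤forms χ Z ⟩
      size Z + (form (adjw (R χ)) (ind Z) + form (adjw (B χ)) (ind Z))
        ≤⟨ +-mono-≤ (size≤n Z) (+-mono-≤
             (≤-trans (form-mono (adjw (R χ)) (ind-mono Z Y (∩-⊆ˡ Y Y′))) Y-sparse)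
             (≤-trans (form-mono (adjw (B χ)) (ind-mono Z Y′ (∩-⊆ʳ Y Y′))) Y′-sparse)) ⟩
      n + (2 * (suc v * n) + 2 * (suc v * n))
        ≤⟨ m≤m+n _ (2 * n) ⟩
      n + (2 * (suc v * n) + 2 * (suc v * n)) + 2 * n
        ≡⟨ regroup (suc v) n ⟩
      slack v * n ∎))
  where
  open ≤-Reasoning
  Z = Y ∩ Y′
  1≤n : 1 ≤ n
  1≤n = ≤-trans (s≤s z≤n) big
  regroup : ∀ k n → n + (2 * (k * n) + 2 * (k * n)) + 2 * n ≡ (4 * k + 3) * n
  regroup = solve-∀

-- Decidability and minimality

-- Functions between finite sets are enumerated by numeric codes. Decoding recovers a function only
-- pointwise, hence the demand that `P` respect `≗`.
any-function? : ∀ {m n} {P : (Fin m → Fin n) → Set} → (∀ {f g} → f ≗ g → P f → P g) →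
                (∀ f → Dec (P f)) → Dec (∃ P)
any-function? resp P? = map′ (λ (k , p) → finToFun k , p)
  (λ (f , p) → funToFin f , resp (sym ∘ finToFun-funToFin f) p)
  (any? (P? ∘ finToFun))

all-functions? : ∀ {m n} {P : (Fin m → Fin n) → Set} → (∀ {f g} → f ≗ g → P f → P g) →
                 (∀ f → Dec (P f)) → Dec (∀ f → P f)
all-functions? resp P? = map′ (λ p f → resp (finToFun-funToFin f) (p (funToFin f)))
  (λ p k → p (finToFun k)) (all? (P? ∘ finToFun))

-- Passing to forms replaces the comparison of two filtered lists by a comparison of summands.
edgesInto-cong : ∀ {v n} (G : Graph v) (H H′ : Graph n) {f g : Fin v → Fin n} →
                 (∀ x y → adj H (f x) (f y) ≡ adj H′ (g x) (g y)) → edgesInto G H f ≡ edgesInto G H′ g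
edgesInto-cong G H H′ {f} {g} eq = *-cancelˡ-≡ _ _ 2 (trans (2edgesInto≡form G H f) (trans
  (form-cong {a = pullw G H f} {pullw G H′ g} {ones} {ones} λ x y →
    cong (λ b → 1 * (𝟙 (adj G x y ∧ b) * 1)) (eq x y))
  (sym (2edgesInto≡form G H′ g))))

e-cong : ∀ {n} (H H′ : Graph n) → (∀ x y → adj H x y ≡ adj H′ x y) → e H ≡ e H′
e-cong H H′ eq = *-cancelˡ-≡ _ _ 2 (trans (2e≡form H) (trans
  (form-cong {a = adjw H} {adjw H′} {ones} {ones} λ x y → cong (λ b → 1 * (𝟙 b * 1)) (eq x y))
  (sym (2e≡form H′))))

injective? : ∀ {m n} (f : Fin m → Fin n) → Dec (Injective _≡_ _≡_ f)
injective? f = map′ (λ inj {x} {y} → inj x y) (λ inj x y → inj)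
  (all? λ x → all? λ y → (f x ≟ f y) →-dec (x ≟ y))

coloredCopy? : ∀ {v n} (G : Graph v) (χ : TwoColoring n) r b → Dec (ColoredCopy G χ r b)
coloredCopy? G χ r b = any-function?
  (λ {f} {g} f≗g (inj , red , blue) →
      (λ {x} {y} eq → inj (trans (f≗g x) (trans eq (sym (f≗g y)))))
    , trans (sym (edgesInto-cong G (R χ) (R χ) λ x y → cong₂ (adj (R χ)) (f≗g x) (f≗g y))) red
    , trans (sym (edgesInto-cong G (B χ) (B χ) λ x y → cong₂ (adj (B χ)) (f≗g x) (f≗g y))) blue)
  (λ f → injective? f ×-dec (edgesInto G (R χ) f ℕ.≟ r) ×-dec (edgesInto G (B χ) f ℕ.≟ b))

Forces : ∀ {v n} → ℕ → Graph v → TwoColoring n → Set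
Forces s G χ = e (R χ) ⊓ e (B χ) > s → ∀ r b → r + b ≡ e G → ColoredCopy G χ r b

forces? : ∀ {v n} s (G : Graph v) (χ : TwoColoring n) → Dec (Forces s G χ)
forces? s G χ = (s <? e (R χ) ⊓ e (B χ)) →-dec map′ to from
  -- Since r determines b as `e G ∸ r`, only the finitely many r ≤ `e G` have to be tested.
  (allUpTo? (λ r → coloredCopy? G χ r (e G ∸ r)) (suc (e G)))
  where
  Bounded Patterns : Set
  Bounded  = ∀ {r} → r < suc (e G) → ColoredCopy G χ r (e G ∸ r)
  Patterns = ∀ r b → r + b ≡ e G → ColoredCopy G χ r b
  to : Bounded → Patterns
  to copies r b r+b≡e = subst (ColoredCopy G χ r)
    (trans (cong (_∸ r) (sym r+b≡e)) (m+n∸m≡n r b))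
    (copies {r} (s≤s (≤-trans (m≤m+n r b) (≤-reflexive r+b≡e))))
  from : Patterns → Bounded
  from copies r<1+e = copies _ _ (m+[n∸m]≡n (≤-pred r<1+e))

-- Enumeration of colourings

infix 4 _≈_

-- Red adjacency determines the colouring: blue is its complement off the diagonal and empty on it.
-- The proof fields of the records are left out of the comparison.
_≈_ : ∀ {n} → TwoColoring n → TwoColoring n → Set
χ ≈ ψ = ∀ x y → adj (R χ) x y ≡ adj (R ψ) x y

≈-blue : ∀ {n} {χ ψ : TwoColoring n} → χ ≈ ψ → ∀ x y → adj (B χ) x y ≡ adj (B ψ) x y
≈-blue {χ = χ} {ψ} χ≈ψ x y with x ≟ y
... | yes refl = trans (adj-irr (B χ) x) (sym (adj-irr (B ψ) x))
... | no x≢y   = trans (partition χ x≢y) (trans (cong not (χ≈ψ x y)) (sym (partition ψ x≢y)))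

forces-resp : ∀ {v n} s (G : Graph v) {χ ψ : TwoColoring n} → χ ≈ ψ → Forces s G χ → Forces s G ψ
forces-resp s G {χ} {ψ} χ≈ψ forces many r b r+b≡e
  with f , inj , red , blue ← forces (subst (s <_)
         (sym (cong₂ _⊓_ (e-cong (R χ) (R ψ) χ≈ψ) (e-cong (B χ) (B ψ) (≈-blue {χ = χ} {ψ} χ≈ψ)))) many) r b r+b≡e
  = f , inj
  , trans (sym (edgesInto-cong G (R χ) (R ψ) λ x y → χ≈ψ (f x) (f y))) red
  , trans (sym (edgesInto-cong G (B χ) (B ψ) λ x y → ≈-blue {χ = χ} {ψ} χ≈ψ (f x) (f y))) blue

distinct : ∀ {n} → Fin n → Fin n → Bool
distinct x y = not (does (x ≟ y))

distinct-sym : ∀ {n} (x y : Fin n) → distinct x y ≡ distinct y x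
distinct-sym x y with x ≟ y
... | yes refl = cong not (sym (dec-true (x ≟ x) refl))
... | no x≢y   = cong not (sym (dec-false (y ≟ x) (≢-sym x≢y)))

distinct-irr : ∀ {n} (x : Fin n) → distinct x x ≡ false
distinct-irr x = cong not (dec-true (x ≟ x) refl)

distinct-≢ : ∀ {n} {x y : Fin n} → x ≢ y → distinct x y ≡ true
distinct-≢ {x = x} {y} x≢y = cong not (dec-false (x ≟ y) x≢y)

-- Symmetrising and clearing the diagonal is the identity on red adjacency matrices,
-- so Boolean matrices enumerate all colourings.
fromMatrix : ∀ {n} → (Fin n → Fin n → Bool) → TwoColoring n
fromMatrix M = record
  { R = record
    { adj     = red
    ; adj-sym = red-sym
    ; adj-irr = λ x → cong (_∧ (M x x ∧ M x x)) (distinct-irr x) }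
  ; B = record
    { adj     = λ x y → distinct x y ∧ not (red x y)
    ; adj-sym = λ x y → cong₂ _∧_ (distinct-sym x y) (cong not (red-sym x y))
    ; adj-irr = λ x → cong (_∧ not (red x x)) (distinct-irr x) }
  ; partition = λ {x} {y} x≢y → cong (_∧ not (red x y)) (distinct-≢ x≢y)
  }
  where
  red = λ x y → distinct x y ∧ (M x y ∧ M y x)
  red-sym = λ x y → cong₂ _∧_ (distinct-sym x y) (Bool.∧-comm (M x y) (M y x))

fromMatrix-cong : ∀ {n} {M M′ : Fin n → Fin n → Bool} → (∀ x y → M x y ≡ M′ x y) → fromMatrix M ≈ fromMatrix M′
fromMatrix-cong eq x y = cong (distinct x y ∧_) (cong₂ _∧_ (eq x y) (eq y x))

fromMatrix-adj : ∀ {n} (χ : TwoColoring n) → fromMatrix (adj (R χ)) ≈ χ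
fromMatrix-adj χ x y with x ≟ y
... | yes refl = sym (adj-irr (R χ) x)
... | no _ = trans (cong (adj (R χ) x y ∧_) (adj-sym (R χ) y x)) (Bool.∧-idem _)

-- A Boolean matrix is flattened to a function between two `Fin` types, the form in which
-- `all-functions?` can enumerate it.
decode : ∀ {n} → (Fin (n * n) → Fin 2) → Fin n → Fin n → Bool
decode g x y = does (g (combine x y) ≟ 1F)

encode : ∀ {n} → (Fin n → Fin n → Bool) → Fin (n * n) → Fin 2
encode {n} M k = if uncurry M (remQuot {n} n k) then 1F else 0F

decode-encode : ∀ {n} (M : Fin n → Fin n → Bool) x y → decode (encode M) x y ≡ M x y
decode-encode {n} M x y =
  trans (cong (λ xy → does ((if uncurry M xy then 1F else 0F) ≟ 1F)) (remQuot-combine {n} x y)) (bit (M x y))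
  where
  bit : ∀ b → does ((if b then 1F else 0F) ≟ 1F) ≡ b
  bit true  = refl
  bit false = refl

-- Testing the colourings of coded matrices suffices: coding and decoding the red matrix of `χ`
-- gives a colouring `≈` to `χ`, and `Forces` respects `≈`.
forcesAllPatterns? : ∀ {v} n (G : Graph v) s → Dec (ForcesAllPatterns n G s)
forcesAllPatterns? n G s = map′
  (λ forces χ → forces-resp s G {fromMatrix (decode (encode (adj (R χ))))} {χ}
    (λ x y → trans (fromMatrix-cong (decode-encode (adj (R χ))) x y) (fromMatrix-adj χ x y))
    (forces (encode (adj (R χ)))))
  (λ forces g → forces (fromMatrix (decode g)))
  (all-functions?
    (λ {g} {h} g≗h → forces-resp s G {fromMatrix (decode g)} {fromMatrix (decode h)}
      (fromMatrix-cong λ x y → cong (λ i → does (i ≟ 1F)) (g≗h (combine x y))))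
    (λ g → forces? s G (fromMatrix (decode g))))

-- The bound by the given witness is kept in the result because it is what places ot(n, G) below
-- half of the edges.
least : ∀ {P : ℕ → Set} → (∀ k → Dec (P k)) → ∀ {m} → P m → ∃[ k ] (P k × (∀ j → P j → k ≤ j)) × k ≤ m
least P? {zero} p = 0 , (p , λ _ _ → z≤n) , z≤n
least {P} P? {suc m} p with P? 0
... | yes p₀ = 0 , (p₀ , λ _ _ → z≤n) , z≤n
... | no ¬p₀ with k , (pk , min) , k≤m ← least {P ∘ suc} (P? ∘ suc) {m} p =
  suc k , (pk , λ { zero p₀ → contradiction p₀ ¬p₀ ; (suc j) pj → s≤s (min j pj) }) , s≤s k≤m

-- Ensures that the predecessor of the half is a genuine one. If `n C 2` were below 2, then n² ≤ n +
-- 2, which fails for n ≥ 4.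
half-positive : ∀ n → 4 ≤ n → 0 < (n C 2) / 2
half-positive n 4≤n = /-monoˡ-≤ 2 2≤nC2
  where
  open ≤-Reasoning
  small : 2 + n < 4 * n
  small = begin-strict
    2 + n       <⟨ +-monoˡ-< n (≤-trans (m≤m+n 3 1) 4≤n) ⟩
    n + n       ≤⟨ +-monoʳ-≤ n (m≤m+n n (n + (n + 0))) ⟩
    4 * n       ∎
  2≤nC2 : 2 ≤ n C 2
  2≤nC2 = ≮⇒≥ λ nC2<2 → <⇒≱ small (begin
    4 * n              ≤⟨ *-monoˡ-≤ n 4≤n ⟩
    n * n              ≡⟨ 2*nC2 n ⟨
    2 * (n C 2) + n    ≤⟨ +-monoˡ-≤ n (*-monoʳ-≤ 2 (≤-pred nC2<2)) ⟩
    2 + n              ∎)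

theorem2p10 : ∀ {v : ℕ} (G : Graph v) → IsTree G → Omnitonal G
-- With this threshold, n ≥ N unfolds to the inequality `25 * slack v < n` that `balanced⇒copies`
-- expects.
theorem2p10 {v} G tree = suc (25 * slack v) , λ n big →
  let 4≤n : 4 ≤ n
      -- `slack v` is at least 7, so n exceeds 25 · 7 = 175 = 4 + 171.
      4≤n = ≤-trans (≤-trans (m≤m+n 4 171) (≤-trans (*-monoʳ-≤ 25 (+-monoˡ-≤ 3 (*-monoʳ-≤ 4 (s≤s z≤n)))) (n≤1+n _))) big
      h = (n C 2) / 2
      h>0 = half-positive n 4≤n
      h≡ : suc (pred h) ≡ h
      h≡ = suc-pred h ⦃ >-nonZero h>0 ⦄
      -- A minimum above h - 1 means that both colours have at least h edges, so h - 1 forces all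
      -- patterns and the least such s satisfies s < h.
      forced : ForcesAllPatterns n G (pred h)
      forced χ many = balanced⇒copies tree big χ
        (≤-trans (≤-trans (≤-reflexive (sym h≡)) many) (m⊓n≤m _ _))
        (≤-trans (≤-trans (≤-reflexive (sym h≡)) many) (m⊓n≤n _ _))
      s , isOt , s≤ = least (forcesAllPatterns? n G) forced
  in s , isOt , ≤-trans (s≤s s≤) (≤-reflexive h≡)
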